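{- Let $m\ge1$ be an integer and $\mu=\lfloor m/3\rfloor$. The group $\mathbb{Z}_m$ contains $\mu$ additively disjoint pairs if and only if $m\not\equiv 6\pmod{12}$. If $m\equiv 6\pmod{12}$, then the maximum number of additively disjoint pairs in $\mathbb{Z}_m$ is $\mu-1$.
   Context: For a finite abelian group $A$, a family of $n$ additively disjoint pairs in $A$ is a family $(a_i,b_i)\in A^2$, $1\le i\le n$, such that the $3n$ elements $a_1,b_1,\ldots,a_n,b_n,a_1+b_1,\ldots,a_n+b_n$ are pairwise distinct. $A$ is called maximally additively disjoint (MAD) if it contains $\lfloor |A|/3\rfloor$ additively disjoint pairs. -}

module Defs where

open import Algebra.Bundles using (AbelianGroup)
import Algebra.Consequences.Propositional as Consequences
import Algebra.Definitions as AlgebraDefinitions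
open import Data.Fin.Base using (Fin; toℕ)
open import Data.Fin.Patterns using (0F; 1F; 2F)
open import Data.Fin.Properties using (toℕ-injective; toℕ-fromℕ<; toℕ<n)
open import Data.Nat.Base using (ℕ; NonZero; >-nonZero⁻¹; _+_; _∸_; _≤_)
open import Data.Nat.DivMod
  using (_%_; _mod_; m%n<n; m<n⇒m%n≡m; n%n≡0; %-distribˡ-+)
open import Data.Nat.Properties using (+-comm; +-assoc; m∸n+n≡m; <⇒≤)
open import Data.Product.Base using (Σ-syntax; _×_; _,_; proj₁; proj₂; uncurry)
open import Function.Definitions using (Injective)
open import Level using (0ℓ; _⊔_)
open import Relation.Binary.PropositionalEquality
  using (_≡_; cong; cong₂; sym; trans; isEquivalence; module ≡-Reasoning)

module _ {c ℓ} (A : AbelianGroup c ℓ) where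

  open AbelianGroup A using (Carrier; _≈_; _∙_)

  elements : ∀ {n} → (Fin n → Carrier × Carrier) → Fin n → Fin 3 → Carrier
  elements p i 0F = proj₁ (p i)
  elements p i 1F = proj₂ (p i)
  elements p i 2F = proj₁ (p i) ∙ proj₂ (p i)

  -- Injectivity on all of Fin n × Fin 3 makes the 3n listed elements
  -- pairwise distinct, both within one pair and across pairs.
  AdditivelyDisjoint : ∀ {n} → (Fin n → Carrier × Carrier) → Set ℓ
  AdditivelyDisjoint p = Injective _≡_ _≈_ (uncurry (elements p))

  ContainsAdditivelyDisjointPairs : ℕ → Set (c ⊔ ℓ)
  ContainsAdditivelyDisjointPairs n =
    Σ[ p ∈ (Fin n → Carrier × Carrier) ] AdditivelyDisjoint p

  IsMaximumNumberOfAdditivelyDisjointPairs : ℕ → Set (c ⊔ ℓ)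
  IsMaximumNumberOfAdditivelyDisjointPairs k =
    ContainsAdditivelyDisjointPairs k ×
    (∀ n → ContainsAdditivelyDisjointPairs n → n ≤ k)

module _ (m : ℕ) .{{_ : NonZero m}} where

  open AlgebraDefinitions {A = Fin m} _≡_
  open ≡-Reasoning

  infixl 6 _+ₘ_

  _+ₘ_ : Fin m → Fin m → Fin m
  a +ₘ b = (toℕ a + toℕ b) mod m

  0ₘ : Fin m
  0ₘ = 0 mod m

  -ₘ_ : Fin m → Fin m
  -ₘ a = (m ∸ toℕ a) mod m

  toℕ-mod : ∀ k → toℕ (k mod m) ≡ k % m
  toℕ-mod k = toℕ-fromℕ< (m%n<n k m)

  toℕ-% : ∀ (a : Fin m) → toℕ a % m ≡ toℕ a
  toℕ-% a = m<n⇒m%n≡m (toℕ<n a)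

  mod-cong : ∀ {j k} → j % m ≡ k % m → j mod m ≡ k mod m
  mod-cong {j} {k} eq =
    toℕ-injective (trans (toℕ-mod j) (trans eq (sym (toℕ-mod k))))

  mod-toℕ : ∀ (a : Fin m) → toℕ a mod m ≡ a
  mod-toℕ a = toℕ-injective (trans (toℕ-mod (toℕ a)) (toℕ-% a))

  mod-homo : ∀ j k → j mod m +ₘ k mod m ≡ (j + k) mod m
  mod-homo j k = mod-cong (begin
    (toℕ (j mod m) + toℕ (k mod m)) % m  ≡⟨ cong₂ (λ x y → (x + y) % m) (toℕ-mod j) (toℕ-mod k) ⟩
    (j % m + k % m) % m                  ≡⟨ %-distribˡ-+ j k m ⟨
    (j + k) % m                          ∎)

  +ₘ-comm : Commutative _+ₘ_
  +ₘ-comm a b = cong (_mod m) (+-comm (toℕ a) (toℕ b))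

  +ₘ-assoc : Associative _+ₘ_
  +ₘ-assoc a b c = begin
    (x + y) mod m +ₘ c        ≡⟨ cong ((x + y) mod m +ₘ_) (mod-toℕ c) ⟨
    (x + y) mod m +ₘ z mod m  ≡⟨ mod-homo (x + y) z ⟩
    (x + y + z) mod m         ≡⟨ cong (_mod m) (+-assoc x y z) ⟩
    (x + (y + z)) mod m       ≡⟨ mod-homo x (y + z) ⟨
    x mod m +ₘ (y + z) mod m  ≡⟨ cong (_+ₘ (y + z) mod m) (mod-toℕ a) ⟩
    a +ₘ (y + z) mod m        ∎
    where
    x = toℕ a
    y = toℕ b
    z = toℕ c

  +ₘ-identityˡ : LeftIdentity 0ₘ _+ₘ_
  +ₘ-identityˡ a = begin
    0 mod m +ₘ a            ≡⟨ cong (0 mod m +ₘ_) (mod-toℕ a) ⟨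
    0 mod m +ₘ toℕ a mod m  ≡⟨ mod-homo 0 (toℕ a) ⟩
    toℕ a mod m             ≡⟨ mod-toℕ a ⟩
    a                       ∎

  -ₘ-inverseˡ : LeftInverse 0ₘ -ₘ_ _+ₘ_
  -ₘ-inverseˡ a = begin
    (m ∸ toℕ a) mod m +ₘ a            ≡⟨ cong ((m ∸ toℕ a) mod m +ₘ_) (mod-toℕ a) ⟨
    (m ∸ toℕ a) mod m +ₘ toℕ a mod m  ≡⟨ mod-homo (m ∸ toℕ a) (toℕ a) ⟩
    (m ∸ toℕ a + toℕ a) mod m         ≡⟨ cong (_mod m) (m∸n+n≡m (<⇒≤ (toℕ<n a))) ⟩
    m mod m                           ≡⟨ mod-cong (trans (n%n≡0 m) (sym (m<n⇒m%n≡m (>-nonZero⁻¹ m)))) ⟩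
    0 mod m                           ∎

  ℤ/ : AbelianGroup 0ℓ 0ℓ
  ℤ/ = record
    { Carrier = Fin m
    ; _≈_     = _≡_
    ; _∙_     = _+ₘ_
    ; ε       = 0ₘ
    ; _⁻¹     = -ₘ_
    ; isAbelianGroup = record
      { isGroup = record
        { isMonoid = record
          { isSemigroup = record
            { isMagma = record { isEquivalence = isEquivalence ; ∙-cong = cong₂ _+ₘ_ }
            ; assoc   = +ₘ-assoc
            }
          ; identity = Consequences.comm∧idˡ⇒id +ₘ-comm +ₘ-identityˡ
          }
        ; inverse = Consequences.comm∧invˡ⇒inv +ₘ-comm -ₘ-inverseˡ
        ; ⁻¹-cong = cong -ₘ_
        }
      ; comm = +ₘ-comm
      }
    }

{-# OPTIONS --safe #-}
-- If m ≡ 6 (mod 12), then m/3 triples (a, b, a + b) would exhaust ℤ/m; since m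
-- is even, the residues in each triple have even sum, whereas 0 + ⋯ + (m − 1) is odd.
--
-- For the constructions, partition {1, …, 3n} into triples (a, b, a + b), as
-- Skolem sequences do; an interval of length at least 3n and at most m is
-- injective modulo m. A Skolem sequence of order 4q + 1 settles
-- m = 12q + 3, …, 12q + 6, the last with one pair less than ⌊m/3⌋. For the other
-- residues take one of order 4s that contains the triples (1, 12s − 1, 12s) and
-- (2, 12s − 4, 12s − 2). Dropping the first one leaves {2, …, 12s − 2}, which
-- suits m = 12s − 3, …, 12s − 1; dropping both leaves {3, …, 12s − 3} without
-- 12s − 4, which suits m = 12s − 5 and m = 12s − 4. The triples of both
-- sequences form four nests of equal length and a few exceptional ones.
module Submission where

open import Defs
open import Data.Nat.Base using (ℕ; NonZero; _/_; _%_; _∸_)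
open import Data.Product.Base using (_×_)
open import Function.Bundles using (_⇔_)
open import Relation.Binary.PropositionalEquality using (_≡_; _≢_)

open import Algebra.Bundles using (AbelianGroup)
import Algebra.Properties.AbelianGroup as AbelianGroupProperties
import Algebra.Properties.CommutativeMonoid.Sum as CommutativeMonoidSum
open import Data.Fin.Base using (Fin; zero; suc; toℕ; punchOut; remQuot)
open import Data.Fin.Patterns using (0F; 1F; 2F; 3F; 4F; 5F; 6F; 7F; 8F; 9F)
open import Data.Fin.Permutation using (permutation)
open import Data.Fin.Properties
  using (any?; punchOut-injective; injective⇒≤; toℕ<n; *↔×; +↔⊎)
  renaming (_≟_ to _≟ᶠ_)
open import Data.List.Base using (List; []; _∷_; _++_; length; lookup; map; concatMap; applyUpTo)
open import Data.List.Membership.Propositional using (_∈_; find)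
import Data.List.Membership.DecPropositional as DecMembership
open import Data.List.Membership.Propositional.Properties using (∈-map⁺; ∈-map⁻)
open import Data.List.Properties using (length-++; length-map; length-applyUpTo)
open import Data.List.Relation.Unary.Any as Any using (Any; here; there; index)
open import Data.List.Relation.Unary.Any.Properties
  using (lookup-index; map⁺; concatMap⁺; concatMap⁻; ++⁺ˡ; ++⁺ʳ; ++⁻; applyUpTo⁺)
open import Data.Nat.Base using (zero; suc; _+_; _*_; _≤_; _<_; s≤s; s≤s⁻¹; parity)
open import Data.Nat.Divisibility using (n∣m*n)
open import Data.Nat.DivMod
  using (_mod_; _divMod_; result; m≡m%n+[m/n]*n; m<n⇒m%n≡m; [m+kn]%n≡m%n;
         +-distrib-/-∣ʳ; m*n/n≡m; /-monoˡ-≤)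
import Data.Nat.Properties as ℕ
open import Data.Nat.Tactic.RingSolver using (solve-∀)
open import Data.Parity.Base using (Parity; 0ℙ; 1ℙ; _⁻¹) renaming (_+_ to _+ᴾ_; _*_ to _*ᴾ_)
import Data.Parity.Properties as Parity
open import Data.Product.Base using (Σ-syntax; ∃; _,_; map₁; proj₁; proj₂; uncurry)
open import Data.Product.Properties using (≡-dec)
open import Data.Sum.Base using (_⊎_; inj₁; inj₂; [_,_]′)
open import Data.Sum.Function.Propositional using (_⊎-↔_)
open import Data.Sum.Properties using (inj₁-injective)
open import Function.Base using (_∘_)
open import Function.Bundles using (_↔_; Injection; Inverse; mk⇔)
open import Function.Construct.Composition using (_↔-∘_)
open import Function.Construct.Identity using (↔-id)
open import Function.Definitions using (Injective; StrictlySurjective)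
open import Function.Properties.Inverse using (↔-sym; ↔⇒↣)
open import Relation.Binary.PropositionalEquality
  using (refl; sym; trans; cong; cong₂; subst; subst₂; module ≡-Reasoning)
open import Relation.Nullary using (¬_; yes; no; contradiction)

-- Injections and surjections between finite sets of equal size.

injective⇒surjective : ∀ {m n} {f : Fin m → Fin n} → m ≡ n →
  Injective _≡_ _≡_ f → StrictlySurjective _≡_ f
injective⇒surjective {n = suc n} {f} refl inj y with any? (λ x → f x ≟ᶠ y)
... | yes found = found
... | no none = contradiction
  -- Pigeonhole: deleting the missed value `y` from the codomain would leave an injection from
  -- `suc n` elements to `n`.
  (injective⇒≤ {f = λ x → punchOut (y≢f x)}
    (λ {x} {x′} eq → inj (punchOut-injective (y≢f x) (y≢f x′) eq)))
  ℕ.1+n≰n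
  where
  y≢f : ∀ x → y ≢ f x
  y≢f x eq = none (x , sym eq)

-- A section `g` of `f` is injective, hence surjective by the count, hence a two-sided inverse of
-- `f`.
surjective⇒injective : ∀ {a} {A : Set a} {m n} {f : A → Fin m} → A ↔ Fin n → n ≡ m →
  StrictlySurjective _≡_ f → Injective _≡_ _≡_ f
surjective⇒injective {A = A} {f = f} A↔Fin n≡m surj {x} {y} fx≡fy = begin
  x        ≡⟨ g-f x ⟨
  g (f x)  ≡⟨ cong g fx≡fy ⟩
  g (f y)  ≡⟨ g-f y ⟩
  y        ∎
  where
  open ≡-Reasoning
  open Inverse A↔Fin

  g : _ → A
  g = proj₁ ∘ surj

  g-injective : Injective _≡_ _≡_ (to ∘ g)
  g-injective {u} {v} eq = begin
    u        ≡⟨ proj₂ (surj u) ⟨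
    f (g u)  ≡⟨ cong f (trans (sym (inverseʳ refl)) (trans (cong from eq) (inverseʳ refl))) ⟩
    f (g v)  ≡⟨ proj₂ (surj v) ⟩
    v        ∎

  g-f : ∀ z → g (f z) ≡ z
  g-f z with u , eq ← injective⇒surjective (sym n≡m) g-injective (to z) = begin
    g (f z)      ≡⟨ cong (g ∘ f) z≡gu ⟩
    g (f (g u))  ≡⟨ cong g (proj₂ (surj u)) ⟩
    g u          ≡⟨ z≡gu ⟨
    z            ∎
    where
    z≡gu : z ≡ g u
    z≡gu = trans (sym (inverseʳ refl)) (trans (cong from (sym eq)) (inverseʳ refl))

-- From covered windows of integers to disjoint pairs of residues.

Covers : (ℕ → Set) → ℕ → ℕ → Set
Covers P a c = ∀ {v} → v < c → a ≤ v → P v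

triple : ℕ × ℕ → List ℕ
triple (a , b) = a ∷ b ∷ a + b ∷ []

triples : List (ℕ × ℕ) → List ℕ
triples = concatMap triple

module _ (m : ℕ) .{{_ : NonZero m}} where

  open AbelianGroup (ℤ/ m) using (assoc) renaming (_∙_ to infixl 6 _⊕_; _⁻¹ to ⊖_)
  open AbelianGroupProperties (ℤ/ m) using (xyx⁻¹≈y)

  residues : (ps : List (ℕ × ℕ)) → Fin (length ps) → Fin m × Fin m
  residues ps i = proj₁ (lookup ps i) mod m , proj₂ (lookup ps i) mod m

  -- The representative is `a` plus the least residue of `w` - `a`.
  window-residue : ∀ a (w : Fin m) → Σ[ v ∈ ℕ ] (a ≤ v × v < a + m × v mod m ≡ w)
  window-residue a w =
    a + toℕ u , ℕ.m≤m+n a _ , ℕ.+-monoʳ-< a (toℕ<n u) , (begin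
      (a + toℕ u) mod m           ≡⟨ mod-homo m a (toℕ u) ⟨
      a mod m ⊕ toℕ u mod m       ≡⟨ cong (a mod m ⊕_) (mod-toℕ m u) ⟩
      a mod m ⊕ (w ⊕ ⊖ (a mod m))  ≡⟨ assoc (a mod m) w _ ⟨
      a mod m ⊕ w ⊕ ⊖ (a mod m)    ≡⟨ xyx⁻¹≈y (a mod m) w ⟩
      w                           ∎)
    where
    open ≡-Reasoning
    u = w ⊕ ⊖ (a mod m)

  triples-elements : ∀ ps {v} → v ∈ triples ps →
    ∃ λ x → uncurry (elements (ℤ/ m) (residues ps)) x ≡ v mod m
  triples-elements ps v∈ = go (concatMap⁻ triple v∈)
    where
    go : ∀ {v} → Any ((v ∈_) ∘ triple) ps →
      ∃ λ x → uncurry (elements (ℤ/ m) (residues ps)) x ≡ v mod m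
    go p with lookup-index p
    ... | here eq                 = (index p , 0F) , cong (_mod m) (sym eq)
    ... | there (here eq)         = (index p , 1F) , cong (_mod m) (sym eq)
    ... | there (there (here eq)) = (index p , 2F) , trans (mod-homo m _ _) (cong (_mod m) (sym eq))

  -- The m listed numbers hit all m residue classes, hence each class once.
  window⇒disjoint : ∀ ps es a → length ps * 3 + length es ≡ m →
    Covers (_∈ es ++ triples ps) a (a + m) →
    AdditivelyDisjoint (ℤ/ m) (residues ps)
  window⇒disjoint ps es a size covers = inj₁-injective ∘ surjective⇒injective
    (↔-sym +↔⊎ ↔-∘ (↔-sym (*↔× {length ps}) ⊎-↔ ↔-id _)) size surjective
    where
    f : (Fin (length ps) × Fin 3) ⊎ Fin (length es) → Fin m
    f = [ uncurry (elements (ℤ/ m) (residues ps)) , (λ i → lookup es i mod m) ]′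

    surjective : StrictlySurjective _≡_ f
    surjective w with v , a≤v , v<a+m , refl ← window-residue a w
      with ++⁻ es (covers v<a+m a≤v)
    ... | inj₁ v∈ = inj₂ (index v∈) , cong (_mod m) (sym (lookup-index v∈))
    ... | inj₂ v∈ with x , eq ← triples-elements ps v∈ = inj₁ x , eq

-- The parity obstruction.

open CommutativeMonoidSum Parity.+-0-commutativeMonoid using (sum; sum-permute)

parity-% : ∀ {m} .{{_ : NonZero m}} → parity m ≡ 0ℙ → ∀ k → parity (k % m) ≡ parity k
parity-% {m} even k = sym (begin
  parity k
    ≡⟨ cong parity (m≡m%n+[m/n]*n k m) ⟩
  parity (k % m + k / m * m)
    ≡⟨ Parity.+-homo-+ (k % m) (k / m * m) ⟩
  parity (k % m) +ᴾ parity (k / m * m)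
    ≡⟨ cong (parity (k % m) +ᴾ_) (Parity.*-homo-* (k / m) m) ⟩
  parity (k % m) +ᴾ (parity (k / m) *ᴾ parity m)
    ≡⟨ cong (λ p → parity (k % m) +ᴾ (parity (k / m) *ᴾ p)) even ⟩
  parity (k % m) +ᴾ (parity (k / m) *ᴾ 0ℙ)
    ≡⟨ cong (parity (k % m) +ᴾ_) (Parity.*-zeroʳ (parity (k / m))) ⟩
  parity (k % m) +ᴾ 0ℙ
    ≡⟨ Parity.+-identityʳ _ ⟩
  parity (k % m)  ∎)
  where open ≡-Reasoning

sum-parity : ∀ j → sum {2 + j * 4} (parity ∘ toℕ) ≡ 1ℙ
sum-parity zero    = refl
-- The four leading terms 0, 1, 2, 3 contain two odd numbers, whence two inversions; removing them
-- shifts the other terms by 4, which preserves parity.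
sum-parity (suc j) = cong (λ p → (p ⁻¹) ⁻¹) (sum-parity j)

-- `remQuot` lists the triples one after another, and each contributes x + y + z = z + z, which
-- vanishes modulo 2.
sum-remQuot : ∀ n (h : Fin n × Fin 3 → Parity) →
  (∀ i → h (i , 0F) +ᴾ h (i , 1F) ≡ h (i , 2F)) → sum (h ∘ remQuot {n} 3) ≡ 0ℙ
sum-remQuot zero    h closed = refl
sum-remQuot (suc n) h closed = begin
  x +ᴾ (y +ᴾ (z +ᴾ sum (h ∘ map₁ suc ∘ remQuot {n} 3)))
    ≡⟨ cong (λ s → x +ᴾ (y +ᴾ (z +ᴾ s))) (sum-remQuot n (h ∘ map₁ suc) (closed ∘ suc)) ⟩
  x +ᴾ (y +ᴾ (z +ᴾ 0ℙ))  ≡⟨ cong (λ s → x +ᴾ (y +ᴾ s)) (Parity.+-identityʳ z) ⟩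
  x +ᴾ (y +ᴾ z)          ≡⟨ Parity.+-assoc x y z ⟨
  x +ᴾ y +ᴾ z            ≡⟨ cong (_+ᴾ z) (closed 0F) ⟩
  z +ᴾ z                 ≡⟨ Parity.p+p≡0ℙ z ⟩
  0ℙ                     ∎
  where
  open ≡-Reasoning
  x = h (0F , 0F)
  y = h (0F , 1F)
  z = h (0F , 2F)

module _ {m n : ℕ} .{{_ : NonZero m}} where

  enumeration : (Fin n → Fin m × Fin m) → Fin (n * 3) → Fin m
  enumeration p = uncurry (elements (ℤ/ m) p) ∘ remQuot {n} 3

  enumeration-injective : ∀ {p} → AdditivelyDisjoint (ℤ/ m) p →
    Injective _≡_ _≡_ (enumeration p)
  enumeration-injective disjoint = Injection.injective (↔⇒↣ (*↔× {n})) ∘ disjoint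

no-partition : ∀ {m n} .{{_ : NonZero m}} j → m ≡ 2 + j * 4 → n * 3 ≡ m →
  ¬ ContainsAdditivelyDisjointPairs (ℤ/ m) n
no-partition {m} {n} j m≡ size (p , disjoint) = contradiction
  (begin
    1ℙ                                                    ≡⟨ odd-sum m≡ ⟨
    sum {m} (parity ∘ toℕ)                                ≡⟨ sum-permute (parity ∘ toℕ) π ⟩
    sum (parity ∘ toℕ ∘ enumeration p)                    ≡⟨ sum-remQuot n (parity ∘ toℕ ∘ uncurry els) closed ⟩
    0ℙ                                                    ∎)
  λ()
  where
  open ≡-Reasoning
  els = elements (ℤ/ m) p

  odd-sum : ∀ {k} → k ≡ 2 + j * 4 → sum {k} (parity ∘ toℕ) ≡ 1ℙ
  odd-sum refl = sum-parity j

  even : parity m ≡ 0ℙ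
  even = trans (cong parity m≡) (trans (Parity.*-homo-* j 4) (Parity.*-zeroʳ (parity j)))

  e-surjective : StrictlySurjective _≡_ (enumeration p)
  -- Here `size` enters: the triples use up all residues, so that enumerating them permutes `Fin m`.
  e-surjective = injective⇒surjective size (enumeration-injective disjoint)

  π = permutation (enumeration p) (proj₁ ∘ e-surjective) (proj₂ ∘ e-surjective)
    (λ i → enumeration-injective disjoint (proj₂ (e-surjective (enumeration p i))))

  closed : ∀ i → parity (toℕ (els i 0F)) +ᴾ parity (toℕ (els i 1F)) ≡ parity (toℕ (els i 2F))
  closed i = begin
    parity x +ᴾ parity y             ≡⟨ Parity.+-homo-+ x y ⟨
    parity (x + y)                   ≡⟨ parity-% even (x + y) ⟨
    parity ((x + y) % m)             ≡⟨ cong parity (toℕ-mod m (x + y)) ⟨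
    parity (toℕ ((x + y) mod m))     ∎
    where
    x = toℕ (proj₁ (p i))
    y = toℕ (proj₂ (p i))

-- Families of triples with affine parameters.

-- The pair (α , β) stands for the affine function k ↦ α k + β.
Affine : Set
Affine = ℕ × ℕ

open DecMembership (≡-dec ℕ._≟_ ℕ._≟_) using (_∈?_)

infix 8 _at_
_at_ : Affine → ℕ → ℕ
(α , β) at k = β + k * α

infixl 6 _⊞_
_⊞_ : Affine → Affine → Affine
(α , β) ⊞ (γ , δ) = α + γ , β + δ

⊞-at : ∀ x y k → (x ⊞ y) at k ≡ x at k + y at k
⊞-at (α , β) (γ , δ) k = lemma α β γ δ k
  where
  lemma : ∀ α β γ δ k → β + δ + k * (α + γ) ≡ β + k * α + (δ + k * γ)
  lemma = solve-∀

shift : Affine → Affine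
shift (α , β) = α , suc β

-- Raising the slope moves past an interval of length `k`, as `shift` moves past a single point.
widen : Affine → Affine
widen (α , β) = suc α , β

widen-at : ∀ x k → widen x at k ≡ x at k + k
widen-at (α , β) k = lemma α β k
  where
  lemma : ∀ α β k → β + k * suc α ≡ β + k * α + k
  lemma = solve-∀

-- One description for all `k`: an entry of `singles` yields one triple, an entry of `nests` yields
-- `k` triples, and `extras` are padding numbers outside the triples. As in a Skolem sequence, `d`
-- is a difference, `l` the left position and d + l the right one.
record Template : Set where
  field
    singles nests : List (Affine × Affine)
    extras        : List Affine

  single : ℕ → Affine × Affine → ℕ × ℕ
  single k (d , l) = d at k , l at k

  -- The i-th pair of a nest is (d + 1 + 2j , l + i) with i + j = k − 1, so that
  -- a + b = d + l + k + j: the sums and the second components run through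
  -- intervals of length k, and the first components through every other number.
  nested : ℕ → Affine × Affine → ℕ → ℕ × ℕ
  nested k (d , l) i = suc (d at k + 2 * (k ∸ suc i)) , l at k + i

  pairs : ℕ → List (ℕ × ℕ)
  pairs k = map (single k) singles ++ concatMap (λ n → applyUpTo (nested k n) k) nests

  Value : ℕ → ℕ → Set
  Value k = _∈ map (_at k) extras ++ triples (pairs k)

  tripleᴬ : Affine × Affine → List Affine
  tripleᴬ (d , l) = d ∷ l ∷ d ⊞ l ∷ []

  -- Starting values of the three shapes that make up the values: isolated numbers, intervals of
  -- length `k`, and progressions of `k` terms with difference 2.
  points rays combs : List Affine
  points = extras ++ concatMap tripleᴬ singles
  rays   = concatMap (λ (d , l) → l ∷ widen (d ⊞ l) ∷ []) nests
  combs  = map (shift ∘ proj₁) nests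

  point-value : ∀ k {x} → x ∈ points → Value k (x at k)
  point-value k x∈ with ++⁻ extras x∈
  ... | inj₁ x∈extras  = ++⁺ˡ (∈-map⁺ (_at k) x∈extras)
  ... | inj₂ x∈singles = ++⁺ʳ (map (_at k) extras) (concatMap⁺ triple
    (++⁺ˡ (map⁺ (Any.map (λ {s} → at-triple s) (concatMap⁻ tripleᴬ {xs = singles} x∈singles)))))
    where
    at-triple : ∀ s {x} → x ∈ tripleᴬ s → x at k ∈ triple (single k s)
    at-triple s       (here refl)                 = here refl
    at-triple s       (there (here refl))         = there (here refl)
    at-triple (d , l) (there (there (here refl))) = there (there (here (⊞-at d l k)))

  nested-value : ∀ k {n i v} → n ∈ nests → i < k → v ∈ triple (nested k n i) → Value k v
  nested-value k {n} n∈ i<k v∈ = ++⁺ʳ (map (_at k) extras) (concatMap⁺ triple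
    (++⁺ʳ (map (single k) singles) (concatMap⁺ _
      (Any.map (λ { refl → applyUpTo⁺ (nested k n) v∈ i<k }) n∈))))

  k∸1+i<k : ∀ {k i} → i < k → k ∸ suc i < k
  k∸1+i<k {suc k} {i} _ = s≤s (ℕ.m∸n≤m k i)

  k∸1+i-involutive : ∀ {k i} → i < k → k ∸ suc (k ∸ suc i) ≡ i
  k∸1+i-involutive {suc k} (s≤s i≤k) = ℕ.m∸[m∸n]≡n i≤k

  -- In a nest the sums decrease as the index grows, so the `i`-th smallest sum belongs to the pair
  -- with index k - 1 - i.
  nested-sum : ∀ k d l {i} → i < k →
    widen (d ⊞ l) at k + i ≡ suc (d at k + 2 * i) + (l at k + (k ∸ suc i))
  nested-sum k d l {i} i<k = trans
    (cong (_+ i) (trans (widen-at (d ⊞ l) k) (cong (_+ k) (⊞-at d l k))))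
    (trans (cong (λ n → d at k + l at k + n + i) (sym (ℕ.m+[n∸m]≡n i<k)))
      (lemma (d at k) (l at k) i (k ∸ suc i)))
    where
    lemma : ∀ x y i j → x + y + (suc i + j) + i ≡ suc (x + 2 * i) + (y + j)
    lemma = solve-∀

  ray-value : ∀ k {x i} → x ∈ rays → i < k → Value k (x at k + i)
  ray-value k {x} {i} x∈ i<k with n , n∈ , x∈n ← find (concatMap⁻ _ {xs = nests} x∈) with x∈n
  ... | here refl         = nested-value k n∈ i<k (there (here refl))
  ... | there (here refl) = nested-value k n∈ (k∸1+i<k i<k) (there (there (here
    (trans (nested-sum k (proj₁ n) (proj₂ n) i<k)
      (cong (λ j → suc (proj₁ n at k + 2 * j) + (proj₂ n at k + (k ∸ suc i)))
        (sym (k∸1+i-involutive i<k)))))))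

  comb-value : ∀ k {x i} → x ∈ combs → i < k → Value k (x at k + 2 * i)
  comb-value k x∈ i<k with n , n∈ , refl ← ∈-map⁻ _ x∈ =
    nested-value k n∈ (k∸1+i<k i<k)
      (here (cong (λ j → suc (proj₁ n at k + 2 * j)) (sym (k∸1+i-involutive i<k))))

-- Extending covered intervals and windows.

module _ {P : ℕ → Set} {a : ℕ} where

  covers-point : ∀ {c} → Covers P a c → P c → Covers P a (suc c)
  covers-point {c} covers Pc {v} v<1+c a≤v with ℕ.m≤n⇒m<n∨m≡n (s≤s⁻¹ v<1+c)
  ... | inj₁ v<c  = covers v<c a≤v
  ... | inj₂ refl = Pc

  covers-ray : ∀ {c} n → Covers P a c → (∀ {i} → i < n → P (c + i)) → Covers P a (c + n)
  covers-ray {c} zero    covers ray = subst (Covers P a) (sym (ℕ.+-identityʳ c)) covers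
  covers-ray {c} (suc n) covers ray = subst (Covers P a) (sym (ℕ.+-suc c n))
    (covers-point (covers-ray n covers (ray ∘ ℕ.m<n⇒m<1+n)) (ray (ℕ.n<1+n n)))

  covers-combs : ∀ {c} n → Covers P a c → (∀ {i} → i < n → P (c + 2 * i)) →
    (∀ {i} → i < n → P (suc c + 2 * i)) → Covers P a (c + 2 * n)
  covers-combs {c} zero    covers even odd = subst (Covers P a) (sym (ℕ.+-identityʳ c)) covers
  covers-combs {c} (suc n) covers even odd = subst (Covers P a) (lemma c n)
    (covers-point
      (covers-point (covers-combs n covers (even ∘ ℕ.m<n⇒m<1+n) (odd ∘ ℕ.m<n⇒m<1+n))
        (even (ℕ.n<1+n n)))
      (odd (ℕ.n<1+n n)))
    where
    lemma : ∀ c n → suc (suc (c + 2 * n)) ≡ c + 2 * suc n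
    lemma = solve-∀

-- The numbers es pad the values of the n triples to an interval of length m.
Windowed : ℕ → ℕ → Set
Windowed n m = Σ[ ps ∈ List (ℕ × ℕ) ] Σ[ es ∈ List ℕ ] Σ[ a ∈ ℕ ]
  (length ps ≡ n × n * 3 + length es ≡ m × Covers (_∈ es ++ triples ps) a (a + m))

-- The next number after the window serves as padding. This reaches the moduli for which no further
-- triple is available.
windowed-suc : ∀ {n m} → Windowed n m → Windowed n (suc m)
windowed-suc {n} {m} (ps , es , a , len , size , covers) =
  ps , a + m ∷ es , a , len , trans (ℕ.+-suc (n * 3) (length es)) (cong suc size) ,
  subst (Covers _ a) (sym (ℕ.+-suc a m))
    (covers-point (λ v<c a≤v → there (covers v<c a≤v)) (here refl))

windowed⇒contains : ∀ {n m} .{{_ : NonZero m}} → Windowed n m →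
  ContainsAdditivelyDisjointPairs (ℤ/ m) n
windowed⇒contains {m = m} (ps , es , a , refl , size , covers) =
  residues m ps , window⇒disjoint m ps es a size covers

-- Checking coverage for all `k` by one computation.

module _ (T : Template) where

  open Template T

  -- Extends an interval of values ending just before x by one point, by a ray of
  -- length k, or by two interleaved combs, for all k at once: comparing affine
  -- functions by their coefficients reduces coverage to a computation.
  run : ℕ → Affine → Affine
  run zero       x = x
  run (suc fuel) x with x ∈? points | x ∈? rays | x ∈? combs | shift x ∈? combs
  ... | yes _ | _     | _     | _     = run fuel (shift x)
  ... | no _  | yes _ | _     | _     = run fuel (widen x)
  ... | no _  | no _  | yes _ | yes _ = run fuel (widen (widen x))
  ... | no _  | no _  | _     | _     = x

  run-covers : ∀ fuel x {a} k → Covers (Value k) a (x at k) → Covers (Value k) a (run fuel x at k)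
  run-covers zero       x k covers = covers
  run-covers (suc fuel) x k covers with x ∈? points | x ∈? rays | x ∈? combs | shift x ∈? combs
  ... | yes x∈ | _      | _      | _       =
    run-covers fuel (shift x) k (covers-point covers (point-value k x∈))
  ... | no _   | yes x∈ | _      | _       =
    run-covers fuel (widen x) k
      (subst (Covers _ _) (sym (widen-at x k)) (covers-ray k covers (ray-value k x∈)))
  ... | no _   | no _   | yes x∈ | yes x∈′ =
    run-covers fuel (widen (widen x)) k
      (subst (Covers _ _) (sym widen²-at) (covers-combs k covers (comb-value k x∈) (comb-value k x∈′)))
    where
    widen²-at : widen (widen x) at k ≡ x at k + 2 * k
    widen²-at = trans (widen-at (widen x) k) (trans (cong (_+ k) (widen-at x k)) (lemma (x at k) k))
      where
      lemma : ∀ y k → y + k + k ≡ y + 2 * k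
      lemma = solve-∀
  ... | no _   | no _   | yes _  | no _    = covers
  ... | no _   | no _   | no _   | _       = covers

  length-pairs : ∀ k → length (pairs k) ≡ length singles + k * length nests
  length-pairs k = trans (length-++ (map (single k) singles))
    (cong₂ _+_ (length-map (single k) singles) (length-nests nests))
    where
    length-nests : ∀ ns → length (concatMap (λ n → applyUpTo (nested k n) k) ns) ≡ k * length ns
    length-nests []       = sym (ℕ.*-zeroʳ k)
    length-nests (n ∷ ns) = trans (length-++ (applyUpTo (nested k n) k))
      (trans (cong₂ _+_ (length-applyUpTo (nested k n) k) (length-nests ns))
        (sym (ℕ.*-suc k (length ns))))

  template-windowed : ∀ a →
    -- Fuel 40 suffices: the longest sweep, for `core⁺⁺`, makes 24 moves over points, 8 over rays
    -- and 2 over pairs of combs. The prescribed end is `a` plus the count of all listed values, as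
    -- an affine function of `k`.
    run 40 (0 , a) ≡ (length nests * 3 , a + (length singles * 3 + length extras)) →
    ∀ k → Windowed (length singles + k * length nests)
      (length singles * 3 + length extras + k * (length nests * 3))
  template-windowed a end k =
    pairs k , map (_at k) extras , a , length-pairs k ,
    trans (cong ((length singles + k * length nests) * 3 +_) (length-map (_at k) extras))
      (size (length singles) (length nests) (length extras) k) ,
    subst (Covers (Value k) a) (trans (cong (_at k) end) (ℕ.+-assoc a _ _))
      -- The sweep starts from the empty interval at `a`.
      (run-covers 40 (0 , a) k λ v<c a≤v → contradiction (start≤a a≤v) (ℕ.<⇒≱ v<c))
    where
    start≤a : ∀ {v} → a ≤ v → (0 , a) at k ≤ v
    start≤a = subst (_≤ _) (sym (trans (cong (a +_) (ℕ.*-zeroʳ k)) (ℕ.+-identityʳ a)))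

    size : ∀ s n e k → (s + k * n) * 3 + e ≡ s * 3 + e + k * (n * 3)
    size = solve-∀

-- The explicit sequences and the windows they fill.

-- Order 4k + 5.
skolem : Template
skolem = record
  { singles = ((0 , 1) , (10 , 12)) ∷ ((0 , 2) , (6 , 6)) ∷ ((2 , 3) , (6 , 7)) ∷
              ((2 , 4) , (9 , 11)) ∷ ((4 , 5) , (7 , 9)) ∷ []
  ; nests   = ((2 , 4) , (4 , 6)) ∷ ((0 , 3) , (5 , 6)) ∷ ((2 , 5) , (8 , 11)) ∷
              ((0 , 2) , (9 , 12)) ∷ []
  ; extras  = []
  }

-- Order 4s with s = k + 2, without the triples of 1 and 2; 12k + 20 = 12s − 4.
core : Template
core = record
  { singles = ((4 , 6) , (5 , 9)) ∷ ((2 , 4) , (6 , 10)) ∷ ((4 , 7) , (6 , 11)) ∷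
              ((4 , 5) , (6 , 12)) ∷ ((4 , 8) , (8 , 13)) ∷ ((0 , 3) , (10 , 16)) ∷ []
  ; nests   = ((2 , 4) , (4 , 9)) ∷ ((0 , 3) , (5 , 10)) ∷ ((2 , 5) , (8 , 15)) ∷
              ((0 , 4) , (9 , 16)) ∷ []
  ; extras  = (12 , 20) ∷ []
  }

-- The padding number 12s - 4 of `core` becomes the partner of 2, with sum 12s - 2.
core⁺ : Template
core⁺ = record
  { singles = ((0 , 2) , (12 , 20)) ∷ Template.singles core
  ; nests   = Template.nests core
  ; extras  = []
  }

-- Adding (1, 12s - 1, 12s) completes {1, ..., 12s}.
core⁺⁺ : Template
core⁺⁺ = record
  { singles = ((0 , 1) , (12 , 23)) ∷ Template.singles core⁺
  ; nests   = Template.nests core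
  ; extras  = []
  }

-- Constant functions and no nests put the sporadic small cases, used at k = 0, through the same
-- check as the families.
finite : List (ℕ × ℕ) → List ℕ → Template
finite ps es = record
  { singles = map (λ (d , l) → (0 , d) , (0 , l)) ps
  ; nests   = []
  ; extras  = map (0 ,_) es
  }

windowed-0 : ∀ q → Windowed (q * 4) (q * 12)
windowed-0 0             = template-windowed (finite [] []) 0 refl 0
windowed-0 1             =
  -- This is s = 1, below the range s = k + 2 of `core⁺⁺`.
  template-windowed (finite ((4 , 6) ∷ (3 , 5) ∷ (2 , 7) ∷ (1 , 11) ∷ []) []) 1 refl 0
windowed-0 (suc (suc k)) = template-windowed core⁺⁺ 1 refl k

windowed-3 : ∀ q → Windowed (1 + q * 4) (3 + q * 12)
windowed-3 0       = template-windowed (finite ((1 , 2) ∷ []) []) 1 refl 0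
windowed-3 (suc k) = template-windowed skolem 1 refl k

windowed-7 : ∀ q → Windowed (2 + q * 4) (7 + q * 12)
windowed-7 0       = template-windowed (finite ((1 , 3) ∷ (2 , 5) ∷ []) (6 ∷ [])) 1 refl 0
windowed-7 (suc k) = template-windowed core 3 refl k

windowed-9 : ∀ q → Windowed (3 + q * 4) (9 + q * 12)
windowed-9 0       = template-windowed (finite ((4 , 6) ∷ (3 , 5) ∷ (2 , 7) ∷ []) []) 2 refl 0
windowed-9 (suc k) = template-windowed core⁺ 2 refl k

-- Assembling the residues modulo 12.

[r+q*12]/3 : ∀ q r → (r + q * 12) / 3 ≡ r / 3 + q * 4
[r+q*12]/3 q r = begin
  (r + q * 12) / 3       ≡⟨ cong (λ t → (r + t) / 3) (ℕ.*-assoc q 4 3) ⟨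
  (r + q * 4 * 3) / 3    ≡⟨ +-distrib-/-∣ʳ r (n∣m*n (q * 4)) ⟩
  r / 3 + q * 4 * 3 / 3  ≡⟨ cong (r / 3 +_) (m*n/n≡m (q * 4) 3) ⟩
  r / 3 + q * 4          ∎
  where open ≡-Reasoning

windowed-by-residue : ∀ q (r : Fin 12) → toℕ r ≢ 6 → Windowed (toℕ r / 3 + q * 4) (toℕ r + q * 12)
windowed-by-residue q 0F             _   = windowed-0 q
windowed-by-residue q 1F             _   = windowed-suc (windowed-0 q)
windowed-by-residue q 2F             _   = windowed-suc (windowed-suc (windowed-0 q))
windowed-by-residue q 3F             _   = windowed-3 q
windowed-by-residue q 4F             _   = windowed-suc (windowed-3 q)
windowed-by-residue q 5F             _   = windowed-suc (windowed-suc (windowed-3 q))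
windowed-by-residue q 6F             r≢6 = contradiction refl r≢6
windowed-by-residue q 7F             _   = windowed-7 q
windowed-by-residue q 8F             _   = windowed-suc (windowed-7 q)
windowed-by-residue q 9F             _   = windowed-9 q
windowed-by-residue q (suc 9F)       _   = windowed-suc (windowed-9 q)
windowed-by-residue q (suc (suc 9F)) _   = windowed-suc (windowed-suc (windowed-9 q))

windowed : ∀ m → m % 12 ≢ 6 → Windowed (m / 3) m
windowed m m%12≢6 with result q r refl ← m divMod 12 =
  subst (λ n → Windowed n m) (sym ([r+q*12]/3 q (toℕ r)))
    (windowed-by-residue q r (m%12≢6 ∘ trans m%12≡r))
  where
  m%12≡r : (toℕ r + q * 12) % 12 ≡ toℕ r
  m%12≡r = trans ([m+kn]%n≡m%n (toℕ r) q 12) (m<n⇒m%n≡m (toℕ<n r))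

-- The exceptional residue 6.

module _ {m : ℕ} .{{_ : NonZero m}} (m%12≡6 : m % 12 ≡ 6) where

  private
    q = m / 12

  m≡6+q*12 : m ≡ 6 + q * 12
  m≡6+q*12 = trans (m≡m%n+[m/n]*n m 12) (cong (_+ q * 12) m%12≡6)

  m/3≡2+q*4 : m / 3 ≡ 2 + q * 4
  m/3≡2+q*4 = trans (cong (_/ 3) m≡6+q*12) ([r+q*12]/3 q 6)

  ¬contains : ¬ ContainsAdditivelyDisjointPairs (ℤ/ m) (m / 3)
  -- The witness comes from 6 + 12q = 2 + 4(1 + 3q); as 3 divides `m`, the triples would fill the
  -- group.
  ¬contains = no-partition (1 + q * 3) (trans m≡6+q*12 (lemma₁ q))
    (trans (cong (_* 3) m/3≡2+q*4) (trans (lemma₂ q) (sym m≡6+q*12)))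
    where
    lemma₁ : ∀ q → 6 + q * 12 ≡ 2 + (1 + q * 3) * 4
    lemma₁ = solve-∀

    lemma₂ : ∀ q → (2 + q * 4) * 3 ≡ 6 + q * 12
    lemma₂ = solve-∀

  maximum : IsMaximumNumberOfAdditivelyDisjointPairs (ℤ/ m) (m / 3 ∸ 1)
  maximum = contains , bound
    where
    contains : ContainsAdditivelyDisjointPairs (ℤ/ m) (m / 3 ∸ 1)
    contains = windowed⇒contains (subst₂ Windowed (sym (cong (_∸ 1) m/3≡2+q*4)) (sym m≡6+q*12)
      -- Three padding numbers lead from 12q + 3 to 12q + 6 with 4q + 1 pairs.
      (windowed-suc (windowed-suc (windowed-suc (windowed-3 q)))))

    bound : ∀ n → ContainsAdditivelyDisjointPairs (ℤ/ m) n → n ≤ m / 3 ∸ 1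
    -- Counting elements gives 3n ≤ m, so n ≤ ⌊m/3⌋, and `¬contains` excludes equality.
    bound n pairs@(p , disjoint) = ℕ.<⇒≤pred (ℕ.≤∧≢⇒< n≤m/3 λ { refl → ¬contains pairs })
      where
      n≤m/3 : n ≤ m / 3
      n≤m/3 = subst (_≤ m / 3) (m*n/n≡m n 3)
        (/-monoˡ-≤ 3 (injective⇒≤ (enumeration-injective {p = p} disjoint)))

theorem9p2 : (m : ℕ) .{{_ : NonZero m}} →
    (ContainsAdditivelyDisjointPairs (ℤ/ m) (m / 3) ⇔ (m % 12 ≢ 6)) ×
    (m % 12 ≡ 6 → IsMaximumNumberOfAdditivelyDisjointPairs (ℤ/ m) (m / 3 ∸ 1))
theorem9p2 m =
  mk⇔ (λ contains m%12≡6 → ¬contains m%12≡6 contains) (windowed⇒contains ∘ windowed m) ,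
  maximum
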